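{- Fix integers $n\ge 1$ and $r\ge 1$. Let $P_n$ be the path on vertices $v_1,\dots,v_n$ with edges $v_iv_{i+1}$ ($1\le i\le n-1$), and let $G(n,r)$ be the graph obtained from $P_n$ by attaching $r$ pendant vertices $\ell_{i,1},\dots,\ell_{i,r}$ (each of degree one, adjacent only to $v_i$) to each $v_i$, $1\le i\le n$. Then $$\gamma(G(n,r))=n,\qquad \zeta(G(n,r))=\begin{cases}2^n,& r=1,\\ 1,& r\ge 2.\end{cases}$$ In particular, if $r\ge 2$ the unique minimum dominating set is $\{v_1,\dots,v_n\}$, whereas if $r=1$ the minimum dominating sets are exactly the sets obtained by choosing one vertex from each pair $\{v_i,\ell_{i,1}\}$, $1\le i\le n$, independently.
   Context: For a finite simple graph $G$, a set $D\subseteq V(G)$ is dominating if every vertex of $G$ lies in $D$ or has a neighbor in $D$. The domination number $\gamma(G)$ is the minimum size of a dominating set, and a minimum dominating set is a dominating set of size $\gamma(G)$. The dominion $\zeta(G)$ is the number of dominating sets of $G$ of size $\gamma(G)$. -}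

module Defs where

open import Data.Fin.Base using (Fin; toℕ)
import Data.Fin.Properties as Fin
open import Data.Fin.Subset using (Subset; inside; outside; _∈_; ⁅_⁆; ⋃; ∣_∣)
open import Data.Fin.Subset.Properties using (_∈?_)
open import Data.List.Base as List using (List; []; _∷_; _++_; filter; length)
open import Data.List.Extrema.Nat using (min)
open import Data.Nat.Base using (ℕ; zero; suc; _+_; _*_)
import Data.Nat.Properties as ℕ
open import Data.Product.Base using (_×_; _,_; ∃)
open import Data.Product.Function.NonDependent.Propositional using (_×-↔_)
open import Data.Sum.Base using (_⊎_; inj₁; inj₂; swap)
open import Data.Sum.Function.Propositional using (_⊎-↔_)
import Data.Vec.Base as Vec
open import Function.Base using (_∘_)
open import Function.Bundles using (_↔_; Inverse)
open import Function.Construct.Composition using (_↔-∘_)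
open import Function.Construct.Identity using (↔-id)
open import Function.Construct.Symmetry using (↔-sym)
open import Function.Properties.Inverse using (↔⇒↣)
open import Level using (0ℓ)
open import Relation.Binary.Core using (Rel)
open import Relation.Binary.Definitions
  using (Symmetric; Irreflexive; Decidable; DecidableEquality)
open import Relation.Binary.PropositionalEquality using (_≡_; refl; sym; subst)
open import Relation.Nullary.Decidable using (Dec; yes; no; map′; _×-dec_; _⊎-dec_)
import Relation.Unary as U

------------------------------------------------------------------------
-- Finite simple graphs

record Graph : Set₁ where
  field
    V      : Set
    order  : ℕ
    enum   : V ↔ Fin order
    Adj    : Rel V 0ℓ
    symm   : Symmetric Adj
    irrefl : Irreflexive _≡_ Adj
    adj?   : Decidable Adj

  index : V → Fin order
  index = Inverse.to enum

  vertex : Fin order → V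
  vertex = Inverse.from enum

  vertex-index : ∀ x → vertex (index x) ≡ x
  vertex-index x = Inverse.strictlyInverseʳ enum x

  _≟ᵥ_ : DecidableEquality V
  _≟ᵥ_ = Fin.inj⇒≟ (↔⇒↣ enum)

  VertexSet : Set
  VertexSet = Subset order

  infix 4 _∈ᵥ_
  _∈ᵥ_ : V → VertexSet → Set
  x ∈ᵥ D = index x ∈ D

  setOf : List V → VertexSet
  setOf xs = ⋃ (List.map (⁅_⁆ ∘ index) xs)

  all? : ∀ {P : V → Set} → U.Decidable P → Dec (∀ x → P x)
  all? {P} P? = map′ (λ p x → subst P (vertex-index x) (p (index x)))
                     (λ p i → p (vertex i))
                     (Fin.all? (P? ∘ vertex))

  any? : ∀ {P : V → Set} → U.Decidable P → Dec (∃ P)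
  any? {P} P? = map′ (λ (i , p) → vertex i , p)
                     (λ (x , p) → index x , subst P (sym (vertex-index x)) p)
                     (Fin.any? (P? ∘ vertex))

------------------------------------------------------------------------
-- Domination

subsets : ∀ n → List (Subset n)
subsets zero    = Vec.[] ∷ []
subsets (suc n) = List.map (outside Vec.∷_) (subsets n)
               ++ List.map (inside  Vec.∷_) (subsets n)

module _ (G : Graph) where
  open Graph G

  Dominating : VertexSet → Set
  Dominating D = ∀ x → x ∈ᵥ D ⊎ ∃ λ y → Adj x y × y ∈ᵥ D

  dominating? : U.Decidable Dominating
  dominating? D = all? λ x →
    (index x ∈? D) ⊎-dec any? λ y → adj? x y ×-dec (index y ∈? D)

  -- The first argument of `min` is the size of the full vertex set, which is
  -- itself dominating, so it is never smaller than the true minimum.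
  γ : ℕ
  γ = min order (List.map ∣_∣ (filter dominating? (subsets order)))

  MinimumDominating : VertexSet → Set
  MinimumDominating D = Dominating D × ∣ D ∣ ≡ γ

  minimumDominating? : U.Decidable MinimumDominating
  minimumDominating? D = dominating? D ×-dec (∣ D ∣ ℕ.≟ γ)

  ζ : ℕ
  ζ = length (filter minimumDominating? (subsets order))

------------------------------------------------------------------------
-- Paths, and attaching r pendant vertices to every vertex

path : ℕ → Graph
path n = record
  { V      = Fin n
  ; order  = n
  ; enum   = ↔-id (Fin n)
  ; Adj    = λ i j → suc (toℕ i) ≡ toℕ j ⊎ suc (toℕ j) ≡ toℕ i
  ; symm   = swap
  ; irrefl = λ { refl (inj₁ e) → ℕ.1+n≢n e
               ; refl (inj₂ e) → ℕ.1+n≢n e }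
  ; adj?   = λ i j → (suc (toℕ i) ℕ.≟ toℕ j) ⊎-dec (suc (toℕ j) ℕ.≟ toℕ i)
  }

module _ (r : ℕ) (H : Graph) where
  private module H = Graph H

  PendantVertex : Set
  PendantVertex = H.V ⊎ (H.V × Fin r)

  data PendantAdj : Rel PendantVertex 0ℓ where
    base : ∀ {x y} → H.Adj x y → PendantAdj (inj₁ x) (inj₁ y)
    down : ∀ {x k} → PendantAdj (inj₁ x) (inj₂ (x , k))
    up   : ∀ {x k} → PendantAdj (inj₂ (x , k)) (inj₁ x)

  attachPendants : Graph
  attachPendants = record
    { V      = PendantVertex
    ; order  = H.order + H.order * r
    ; enum   = ↔-sym Fin.+↔⊎ ↔-∘ (H.enum ⊎-↔ (↔-sym Fin.*↔× ↔-∘ (H.enum ×-↔ ↔-id (Fin r))))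
    ; Adj    = PendantAdj
    ; symm   = λ { (base a) → base (H.symm a) ; down → up ; up → down }
    ; irrefl = λ { refl (base a) → H.irrefl refl a }
    ; adj?   = pendantAdj?
    }
    where
    pendantAdj? : Decidable PendantAdj
    pendantAdj? (inj₁ x)       (inj₁ y)       = map′ base (λ { (base a) → a }) (H.adj? x y)
    pendantAdj? (inj₁ x)       (inj₂ (y , k)) = map′ (λ { refl → down }) (λ { down → refl }) (x H.≟ᵥ y)
    pendantAdj? (inj₂ (x , k)) (inj₁ y)       = map′ (λ { refl → up }) (λ { up → refl }) (x H.≟ᵥ y)
    pendantAdj? (inj₂ _)       (inj₂ _)       = no λ ()

G : ℕ → ℕ → Graph
G n r = attachPendants r (path n)

v : ∀ {n r} → Fin n → Graph.V (G n r)
v i = inj₁ i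

ℓ : ∀ {n r} → Fin n → Fin r → Graph.V (G n r)
ℓ i k = inj₂ (i , k)

{-# OPTIONS --safe #-}

-- The n sets {v i, ℓ i 1, …, ℓ i r} are disjoint, and for each leaf ℓ i k a
-- dominating set contains v i or ℓ i k.  So it contains a set picking one vertex
-- from each of them, which has n elements, and a dominating set of size n
-- equals such a set.  If r ≥ 2, a pick of a leaf at i leaves another leaf at i
-- undominated; if r = 1, every pick from the pairs {v i, ℓ i 1} dominates.
module Submission where

open import Defs
open import Data.Bool.Base using (Bool; true; false; if_then_else_)
open import Data.Fin.Base using (Fin; zero; suc; fromℕ<)
open import Data.Fin.Subset using (Subset; inside; outside; _∈_; _∉_; _⊆_; _∪_; ⁅_⁆; ∣_∣)
open import Data.Fin.Subset.Properties
  using (_∈?_; x∈⁅x⁆; x∈⁅y⁆⇒x≡y; x∈p∪q⁺; x∈p∪q⁻; ∪-identityˡ; ∉⊥; ⊥⊆; ∣⊥∣≡0; ⊆-antisym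
        ; p⊆q⇒∣p∣≤∣q∣; p⊂q⇒∣p∣<∣q∣)
open import Data.List.Base using (List; []; _∷_; tabulate; map; filter; length)
open import Data.List.Extrema.Nat using (min≈v⁺)
open import Data.List.Membership.Propositional using () renaming (_∈_ to _∈ₗ_)
open import Data.List.Membership.Propositional.Properties
  using (∈-map⁺; ∈-map⁻; ∈-++⁺ˡ; ∈-++⁺ʳ; ∈-filter⁺; ∈-filter⁻; ∈-tabulate⁺; ∈-tabulate⁻)
open import Data.List.Membership.Propositional.Properties.WithK using (unique∧set⇒bag)
open import Data.List.Properties using (length-map; length-++; length-tabulate; tabulate-cong)
open import Data.List.Relation.Binary.BagAndSetEquality using (∼bag⇒↭)
open import Data.List.Relation.Binary.Permutation.Propositional.Properties using (↭-length)
open import Data.List.Relation.Unary.All as All using (All; []; _∷_)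
import Data.List.Relation.Unary.All.Properties as All
open import Data.List.Relation.Unary.AllPairs using ([]; _∷_)
open import Data.List.Relation.Unary.Any using (here; there)
open import Data.List.Relation.Unary.Unique.Propositional using (Unique)
import Data.List.Relation.Unary.Unique.Propositional.Properties as Unique
open import Data.Nat.Base using (ℕ; zero; suc; _+_; _*_; _≤_; _^_; s≤s; z≤n)
open import Data.Nat.Properties using (+-identityʳ; <-irrefl; m≤m+n)
open import Data.Product.Base using (_×_; _,_; Σ-syntax; ∃; proj₁; proj₂)
open import Data.Sum.Base using (_⊎_; inj₁; inj₂; [_,_])
import Data.Vec.Base as Vec
import Data.Vec.Properties as Vec
open import Function.Base using (_∘_; id; const)
open import Function.Bundles using (_⇔_; mk⇔; Equivalence)
open import Relation.Binary.PropositionalEquality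
  using (_≡_; _≗_; refl; sym; trans; cong; cong₂; subst)
open import Relation.Nullary.Decidable using (decidable-stable)
open import Relation.Nullary.Negation using (¬_; contradiction)

-- Subsets of a finite set and their enumeration

∣⁅x⁆∪p∣≡1+∣p∣ : ∀ {m} {x : Fin m} {p : Subset m} → x ∉ p → ∣ ⁅ x ⁆ ∪ p ∣ ≡ suc ∣ p ∣
∣⁅x⁆∪p∣≡1+∣p∣ {x = zero}  {inside  Vec.∷ p} x∉p = contradiction Vec.here x∉p
∣⁅x⁆∪p∣≡1+∣p∣ {x = zero}  {outside Vec.∷ p} x∉p = cong (suc ∘ ∣_∣) (∪-identityˡ p)
∣⁅x⁆∪p∣≡1+∣p∣ {x = suc x} {inside  Vec.∷ p} x∉p = cong suc (∣⁅x⁆∪p∣≡1+∣p∣ (x∉p ∘ Vec.there))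
∣⁅x⁆∪p∣≡1+∣p∣ {x = suc x} {outside Vec.∷ p} x∉p = ∣⁅x⁆∪p∣≡1+∣p∣ (x∉p ∘ Vec.there)

-- An element of `q` missing from `p` would make the inclusion strict, and hence the sizes
-- different.
p⊆q∧∣p∣≡∣q∣⇒p≡q : ∀ {m} {p q : Subset m} → p ⊆ q → ∣ p ∣ ≡ ∣ q ∣ → p ≡ q
p⊆q∧∣p∣≡∣q∣⇒p≡q {p = p} p⊆q eq = ⊆-antisym p⊆q λ {x} x∈q →
  decidable-stable (x ∈? p) λ x∉p → <-irrefl eq (p⊂q⇒∣p∣<∣q∣ (p⊆q , x , x∈q , x∉p))

∈-subsets : ∀ {m} (p : Subset m) → p ∈ₗ subsets m
∈-subsets Vec.[]            = here refl
∈-subsets (outside Vec.∷ p) = ∈-++⁺ˡ (∈-map⁺ _ (∈-subsets p))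
∈-subsets (inside  Vec.∷ p) = ∈-++⁺ʳ _ (∈-map⁺ _ (∈-subsets p))

subsets-unique : ∀ m → Unique (subsets m)
subsets-unique zero    = [] ∷ []
subsets-unique (suc m) = Unique.++⁺
  (Unique.map⁺ Vec.∷-injectiveʳ (subsets-unique m))
  (Unique.map⁺ Vec.∷-injectiveʳ (subsets-unique m))
  λ (p∈out , p∈in) → disjoint (∈-map⁻ _ p∈out) (∈-map⁻ _ p∈in)
  where
  disjoint : ∀ {p : Subset (suc m)} → ∃ (λ q → q ∈ₗ subsets m × p ≡ outside Vec.∷ q) →
             ¬ ∃ (λ q → q ∈ₗ subsets m × p ≡ inside Vec.∷ q)
  disjoint (_ , _ , refl) (_ , _ , ())

length-subsets : ∀ m → length (subsets m) ≡ 2 ^ m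
length-subsets zero    = refl
length-subsets (suc m) = trans
  (length-++ (map (outside Vec.∷_) (subsets m)))
  (cong₂ _+_
    (trans (length-map _ (subsets m)) (length-subsets m))
    (trans (length-map _ (subsets m)) (trans (length-subsets m) (sym (+-identityʳ _)))))

-- Vertex sets given by lists, and counting minimum dominating sets

module _ (H : Graph) where
  open Graph H

  index-injective : ∀ {x y} → index x ≡ index y → x ≡ y
  index-injective {x} {y} eq = trans (sym (vertex-index x)) (trans (cong vertex eq) (vertex-index y))

  ∈-setOf⁺ : ∀ {x xs} → x ∈ₗ xs → x ∈ᵥ setOf xs
  ∈-setOf⁺ (here refl)  = x∈p∪q⁺ (inj₁ (x∈⁅x⁆ _))
  ∈-setOf⁺ (there x∈xs) = x∈p∪q⁺ (inj₂ (∈-setOf⁺ x∈xs))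

  ∈-setOf⁻ : ∀ {x} xs → x ∈ᵥ setOf xs → x ∈ₗ xs
  ∈-setOf⁻ []       x∈ = contradiction x∈ ∉⊥
  ∈-setOf⁻ (y ∷ xs) x∈ with x∈p∪q⁻ ⁅ index y ⁆ _ x∈
  ... | inj₁ x∈⁅y⁆ = here (index-injective (x∈⁅y⁆⇒x≡y _ x∈⁅y⁆))
  ... | inj₂ x∈xs  = there (∈-setOf⁻ xs x∈xs)

  setOf-⊆ : ∀ {D xs} → All (_∈ᵥ D) xs → setOf xs ⊆ D
  setOf-⊆ []                     = ⊥⊆
  setOf-⊆ {D} (_∷_ {y} y∈D xs∈D) j∈ with x∈p∪q⁻ ⁅ index y ⁆ _ j∈
  ... | inj₁ j∈⁅y⁆ = subst (_∈ D) (sym (x∈⁅y⁆⇒x≡y _ j∈⁅y⁆)) y∈D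
  ... | inj₂ j∈xs  = setOf-⊆ xs∈D j∈xs

  ∣setOf∣ : ∀ {xs} → Unique xs → ∣ setOf xs ∣ ≡ length xs
  ∣setOf∣ []                       = ∣⊥∣≡0 order
  ∣setOf∣ {x ∷ xs} (x≢xs ∷ xs!) = trans
    (∣⁅x⁆∪p∣≡1+∣p∣ (λ x∈ → All.lookup x≢xs (∈-setOf⁻ xs x∈) refl))
    (cong suc (∣setOf∣ xs!))

  -- Two duplicate-free lists with the same members are permutations of each other. Computing `ζ`
  -- thus reduces to listing the minimum dominating sets without repetition.
  ζ≡length : ∀ {Ds} → Unique Ds → (∀ D → MinimumDominating H D ⇔ D ∈ₗ Ds) → ζ H ≡ length Ds
  ζ≡length {Ds} Ds! char = ↭-length (∼bag⇒↭ (unique∧set⇒bag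
    (Unique.filter⁺ (minimumDominating? H) (subsets-unique order)) Ds!
    λ {D} → mk⇔
      (Equivalence.to (char D) ∘ proj₂ ∘ ∈-filter⁻ (minimumDominating? H) {xs = subsets order})
      (∈-filter⁺ (minimumDominating? H) (∈-subsets D) ∘ Equivalence.from (char D))))

-- Transversals and the domination number

module _ {n r : ℕ} where
  open Graph (G n r)

  -- The fibres of `site` are the disjoint sets formed by a path vertex and its leaves; a
  -- transversal is a section of this map.
  site : V → Fin n
  site = [ id , proj₁ ]

  Transversal : (Fin n → V) → Set
  Transversal f = ∀ i → site (f i) ≡ i

  module _ {f : Fin n → V} (site-f : Transversal f) where

    ∣transversal∣ : ∣ setOf (tabulate f) ∣ ≡ n
    ∣transversal∣ = trans (∣setOf∣ (G n r) (Unique.tabulate⁺ λ {i} {j} fi≡fj →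
        trans (sym (site-f i)) (trans (cong site fi≡fj) (site-f j))))
      (length-tabulate f)

    -- A member is `f i` for some `i`, and `site` recovers this `i`. So no second vertex at the same
    -- site can be a member.
    ∈-transversal⁻ : ∀ x → x ∈ᵥ setOf (tabulate f) → x ≡ f (site x)
    ∈-transversal⁻ x x∈
      with i , refl ← ∈-tabulate⁻ (∈-setOf⁻ (G n r) {x} (tabulate f) x∈) =
      cong f (sym (site-f i))

  ∈-setOf-tabulate : ∀ (f : Fin n → V) i → f i ∈ᵥ setOf (tabulate f)
  ∈-setOf-tabulate f i = ∈-setOf⁺ (G n r) (∈-tabulate⁺ i)

  transversal-injective : ∀ {f g} → Transversal f → Transversal g →
                          setOf (tabulate f) ≡ setOf (tabulate g) → f ≗ g
  transversal-injective {f} {g} site-f site-g eq i = trans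
    (∈-transversal⁻ site-g (f i) (subst (index (f i) ∈_) eq (∈-setOf-tabulate f i)))
    (cong g (site-f i))

  -- A single leaf index `k` serves all sites: one leaf per site is enough to force `n` vertices.
  Choice : Fin r → (Fin n → V) → Set
  Choice k f = ∀ i → f i ≡ v i ⊎ f i ≡ ℓ i k

  choice⇒transversal : ∀ {k f} → Choice k f → Transversal f
  choice⇒transversal c i = [ cong site , cong site ] (c i)

  -- The only neighbor of a leaf is the path vertex that carries it.
  dominates-leaf : ∀ {D} → Dominating (G n r) D → ∀ k i → v i ∈ᵥ D ⊎ ℓ i k ∈ᵥ D
  dominates-leaf dom k i with dom (ℓ i k)
  ... | inj₁ ℓ∈D            = inj₂ ℓ∈D
  ... | inj₂ (_ , up , v∈D) = inj₁ v∈D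

  dominating⊇choice : ∀ {D} → Dominating (G n r) D → ∀ k →
                      ∃ λ f → Choice k f × setOf (tabulate f) ⊆ D
  dominating⊇choice {D} dom k =
    proj₁ ∘ pick , proj₁ ∘ proj₂ ∘ pick ,
    setOf-⊆ (G n r) (All.tabulate⁺ (proj₂ ∘ proj₂ ∘ pick))
    where
    pick : ∀ i → ∃ λ x → (x ≡ v i ⊎ x ≡ ℓ i k) × x ∈ᵥ D
    pick i with dominates-leaf dom k i
    ... | inj₁ v∈D = v i , inj₁ refl , v∈D
    ... | inj₂ ℓ∈D = ℓ i k , inj₂ refl , ℓ∈D

  -- The argument in `Fin r` expresses `r ≥ 1` by exhibiting a leaf index.
  dominating⇒n≤∣D∣ : ∀ {D} → Fin r → Dominating (G n r) D → n ≤ ∣ D ∣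
  dominating⇒n≤∣D∣ {D} k dom with f , c , f⊆D ← dominating⊇choice dom k =
    subst (_≤ ∣ D ∣) (∣transversal∣ (choice⇒transversal c)) (p⊆q⇒∣p∣≤∣q∣ f⊆D)

  path-dominating : Dominating (G n r) (setOf (tabulate v))
  path-dominating (inj₁ i)       = inj₁ (∈-setOf-tabulate v i)
  path-dominating (inj₂ (i , k)) = inj₂ (v i , up , ∈-setOf-tabulate v i)

  γ≡n : Fin r → γ (G n r) ≡ n
  γ≡n k = min≈v⁺
    (subst (_∈ₗ sizes) (∣transversal∣ λ _ → refl)
      (∈-map⁺ ∣_∣ (∈-filter⁺ (dominating? (G n r)) (∈-subsets _) path-dominating)))
    (All.map⁺ (All.map (dominating⇒n≤∣D∣ k) (All.all-filter (dominating? (G n r)) (subsets order))))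
    -- The default value of `min` is the order `n + n * r`, so it too must be bounded below by `n`.
    (m≤m+n n (n * r))
    where
    sizes : List ℕ
    sizes = map ∣_∣ (filter (dominating? (G n r)) (subsets order))

  transversal-minimum : ∀ {f} → Fin r → Transversal f → Dominating (G n r) (setOf (tabulate f)) →
                        MinimumDominating (G n r) (setOf (tabulate f))
  transversal-minimum k site-f dom = dom , trans (∣transversal∣ site-f) (sym (γ≡n k))

  minimum⇒choice : ∀ {D} k → MinimumDominating (G n r) D →
                   ∃ λ f → Choice k f × D ≡ setOf (tabulate f)
  minimum⇒choice k (dom , ∣D∣≡γ) with f , c , f⊆D ← dominating⊇choice dom k =
    f , c , sym (p⊆q∧∣p∣≡∣q∣⇒p≡q f⊆D
      (trans (∣transversal∣ (choice⇒transversal c)) (sym (trans ∣D∣≡γ (γ≡n k)))))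

-- At least two leaves per path vertex

module _ {n r : ℕ} where
  open Graph (G n (2 + r))

  dominating-choice⇒v : ∀ {f : Fin n → V} → Choice zero f →
                        Dominating (G n (2 + r)) (setOf (tabulate f)) → f ≗ v
  dominating-choice⇒v {f} c dom i with c i
  ... | inj₁ fi≡v = fi≡v
  ... | inj₂ fi≡ℓ with dominates-leaf dom (suc zero) i
  -- The only member at site `i` is the first leaf, but dominating the second leaf requires `v i` or
  -- that second leaf.
  ...   | inj₁ v∈ with () ← trans (∈-transversal⁻ (choice⇒transversal c) (v i) v∈) fi≡ℓ
  ...   | inj₂ ℓ∈ with () ← trans (∈-transversal⁻ (choice⇒transversal c) (ℓ i (suc zero)) ℓ∈) fi≡ℓ

  minimum⇔path : ∀ D → MinimumDominating (G n (2 + r)) D ⇔ D ≡ setOf (tabulate v)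
  minimum⇔path D = mk⇔ to λ { refl → transversal-minimum zero (λ _ → refl) path-dominating }
    where
    to : MinimumDominating (G n (2 + r)) D → D ≡ setOf (tabulate v)
    to min with f , c , refl ← minimum⇒choice zero min =
      cong setOf (tabulate-cong (dominating-choice⇒v c (proj₁ min)))

  ζ≡1 : ζ (G n (2 + r)) ≡ 1
  ζ≡1 = ζ≡length (G n (2 + r)) ([] ∷ []) λ D → mk⇔
    (here ∘ Equivalence.to (minimum⇔path D))
    λ { (here eq) → Equivalence.from (minimum⇔path D) eq ; (there ()) }

-- Exactly one leaf per path vertex

module _ {n : ℕ} where
  open Graph (G n 1)

  choice-dominating : ∀ {f : Fin n → V} → Choice zero f → Dominating (G n 1) (setOf (tabulate f))
  choice-dominating {f} c = dom
    where
    dom : Dominating (G n 1) (setOf (tabulate f))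
    -- The vertex chosen at the site of `x` is either `x` itself or the other end of the pendant
    -- edge there.
    dom x with ∈-setOf-tabulate f (site x)
    dom (inj₁ i)          | fi∈ with c i
    ... | inj₁ fi≡v = inj₁ (subst (_∈ᵥ setOf (tabulate f)) fi≡v fi∈)
    ... | inj₂ fi≡ℓ = inj₂ (_ , down , subst (_∈ᵥ setOf (tabulate f)) fi≡ℓ fi∈)
    dom (inj₂ (i , zero)) | fi∈ with c i
    ... | inj₁ fi≡v = inj₂ (_ , up , subst (_∈ᵥ setOf (tabulate f)) fi≡v fi∈)
    ... | inj₂ fi≡ℓ = inj₁ (subst (_∈ᵥ setOf (tabulate f)) fi≡ℓ fi∈)

  minimum⇔choice : ∀ D → MinimumDominating (G n 1) D ⇔
                   (Σ[ f ∈ (Fin n → V) ] Choice zero f × D ≡ setOf (tabulate f))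
  minimum⇔choice D = mk⇔ (minimum⇒choice zero)
    λ { (f , c , refl) → transversal-minimum zero (choice⇒transversal c) (choice-dominating c) }

  -- Since `inside` is `true`, a subset of `Fin n` encodes a choice by the sites where the path
  -- vertex is taken; the `2 ^ n` subsets then count the choices.
  fromBool : Fin n → Bool → V
  fromBool i b = if b then v i else ℓ i zero

  fromBool-injective : ∀ i {b c} → fromBool i b ≡ fromBool i c → b ≡ c
  fromBool-injective i {false} {false} _ = refl
  fromBool-injective i {true}  {true}  _ = refl

  fromSubset : Subset n → Fin n → V
  fromSubset s i = fromBool i (Vec.lookup s i)

  fromSubset-choice : ∀ s → Choice zero (fromSubset s)
  fromSubset-choice s i with Vec.lookup s i
  ... | true  = inj₁ refl
  ... | false = inj₂ refl

  fromSubset-surjective : ∀ {f} → Choice zero f → ∃ λ s → f ≗ fromSubset s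
  fromSubset-surjective {f} c = Vec.tabulate chosen , λ i →
    trans (f≡ i) (cong (fromBool i) (sym (Vec.lookup∘tabulate chosen i)))
    where
    chosen : Fin n → Bool
    chosen i = [ const true , const false ] (c i)
    f≡ : ∀ i → f i ≡ fromBool i (chosen i)
    f≡ i with c i
    ... | inj₁ fi≡v = fi≡v
    ... | inj₂ fi≡ℓ = fi≡ℓ

  -- A transversal is determined by its set of values, and at each site the chosen vertex determines
  -- the bit.
  setOf-fromSubset-injective : ∀ {s t} →
    setOf (tabulate (fromSubset s)) ≡ setOf (tabulate (fromSubset t)) → s ≡ t
  setOf-fromSubset-injective {s} {t} eq = trans (sym (Vec.tabulate∘lookup s)) (trans
    (Vec.tabulate-cong λ i → fromBool-injective i (transversal-injective
      (choice⇒transversal (fromSubset-choice s)) (choice⇒transversal (fromSubset-choice t)) eq i))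
    (Vec.tabulate∘lookup t))

  ζ≡2^n : ζ (G n 1) ≡ 2 ^ n
  ζ≡2^n = trans
    (ζ≡length (G n 1) (Unique.map⁺ setOf-fromSubset-injective (subsets-unique n)) λ D → mk⇔ (to D) (from D))
    (trans (length-map _ (subsets n)) (length-subsets n))
    where
    choiceSets : List VertexSet
    choiceSets = map (setOf ∘ tabulate ∘ fromSubset) (subsets n)
    to : ∀ D → MinimumDominating (G n 1) D → D ∈ₗ choiceSets
    to D min with f , c , refl ← minimum⇒choice zero min
      with s , f≗s ← fromSubset-surjective c =
      subst (_∈ₗ choiceSets) (cong setOf (tabulate-cong (sym ∘ f≗s))) (∈-map⁺ _ (∈-subsets s))
    from : ∀ D → D ∈ₗ choiceSets → MinimumDominating (G n 1) D
    from D D∈ with s , _ , eq ← ∈-map⁻ _ D∈ =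
      Equivalence.from (minimum⇔choice D) (fromSubset s , fromSubset-choice s , eq)

theorem3 : (n r : ℕ) → 1 ≤ n → (1≤r : 1 ≤ r) →
    γ (G n r) ≡ n
    × (r ≡ 1 → ζ (G n r) ≡ 2 ^ n)
    × (2 ≤ r → ζ (G n r) ≡ 1)
    × (2 ≤ r → (D : Graph.VertexSet (G n r)) →
    MinimumDominating (G n r) D ⇔ D ≡ Graph.setOf (G n r) (tabulate v))
    × (r ≡ 1 → (D : Graph.VertexSet (G n r)) →
    MinimumDominating (G n r) D
    ⇔ (Σ[ f ∈ (Fin n → Graph.V (G n r)) ]
    ((i : Fin n) → f i ≡ v i ⊎ f i ≡ ℓ i (fromℕ< 1≤r))
    × D ≡ Graph.setOf (G n r) (tabulate f)))
-- After this match `fromℕ< 1≤r` computes to `zero`, the leaf index used in `minimum⇔choice`.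
theorem3 n (suc r) _ (s≤s z≤n) =
    γ≡n zero
  , (λ { refl → ζ≡2^n {n} })
  , (λ { (s≤s (s≤s z≤n)) → ζ≡1 {n} })
  , (λ { (s≤s (s≤s z≤n)) → minimum⇔path })
  , (λ { refl → minimum⇔choice })
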